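{- Let $p$ be an integer, let $n$ and $r$ be non-negative integers, and let $q$ be an integer with $q+r\ge 0$. Then $$\sum_{k=0}^{n}\genfrac{[}{]}{0pt}{}{n+r}{k+r}_{r}B_{k}^{(p)}(q)=n!\,H_{n+1}^{(p,q+r)}.$$
   Context: For an integer $p$, the generalized hyperharmonic numbers are defined by $H_n^{(p,0)}=1/n^p$ for $n\ge 1$ and $H_{n}^{(p,s)}=\sum_{k=1}^{n}H_{k}^{(p,s-1)}$ for integers $s\ge 1$, $n\ge 1$. The $r$-Stirling numbers of the first kind $\genfrac{[}{]}{0pt}{}{n+r}{k+r}_{r}$ ($n,k,r\ge 0$) are defined by the polynomial identity $(x+r)(x+r+1)\cdots(x+r+n-1)=\sum_{k=0}^{n}\genfrac{[}{]}{0pt}{}{n+r}{k+r}_{r}x^{k}$. The poly-Bernoulli polynomials $B_n^{(p)}(x)$ are defined by $\sum_{n=0}^{\infty}B_{n}^{(p)}(x)\frac{t^{n}}{n!}=\frac{\mathrm{Li}_{p}(1-e^{ -t})}{1-e^{ -t}}e^{xt}$, where $\mathrm{Li}_p(t)=\sum_{n=1}^{\infty}t^n/n^p$ (as formal power series). -}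

module Defs where

open import Algebra.Bundles.Raw using (RawSemiring)
import Algebra.Definitions.RawSemiring as RawSemiringDefinitions
open import Data.Fin.Base using (toℕ)
open import Data.Integer.Base using (ℤ; +_; -[1+_])
open import Data.Nat.Base as ℕ using (ℕ; zero; suc; _∸_; _!)
open import Data.Nat.Properties as ℕ using (_!≢0; m^n≢0)
open import Data.Rational.Base
open import Data.Rational.Properties
open import Level using (0ℓ)
open import Relation.Binary.PropositionalEquality

open import Algebra.Properties.CommutativeMonoid.Sum +-0-commutativeMonoid public
  using (sum-syntax; sum⁺-syntax)

open RawSemiringDefinitions +-*-rawSemiring using (_^_)

-- n⁻ᵖ, for an arbitrary integer p.
invPow : ℤ → (n : ℕ) → .{{ℕ.NonZero n}} → ℚ
invPow (+ m)    n = (+ 1 / (n ℕ.^ m)) {{m^n≢0 n m}}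
invPow -[1+ m ] n = + (n ℕ.^ suc m) / 1

-- H p s n is H_n^{(p,s)}; the summation index k = 1, …, n is suc (toℕ j).
H : ℤ → ℕ → (n : ℕ) → .{{ℕ.NonZero n}} → ℚ
H p zero    n = invPow p n
H p (suc s) n = ∑[ j < n ] H p s (suc (toℕ j))

-- Formal power series over ℚ as coefficient sequences. Polynomials are
-- identified with the series having finitely many nonzero coefficients.
Series : Set
Series = ℕ → ℚ

infixl 7 _⊛_ _⊘_
infixl 6 _⊕_ _⊖_
infixr 9 _⊚_

_⊕_ : Series → Series → Series
(f ⊕ g) n = f n + g n

_⊖_ : Series → Series → Series
(f ⊖ g) n = f n - g n

_⊛_ : Series → Series → Series
(f ⊛ g) n = ∑[ k ≤ n ] (f (toℕ k) * g (n ∸ toℕ k))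

const : ℚ → Series
const c zero    = c
const c (suc n) = 0ℚ

-- The indeterminate.
X : Series
X zero          = 0ℚ
X (suc zero)    = 1ℚ
X (suc (suc n)) = 0ℚ

series-rawSemiring : RawSemiring 0ℓ 0ℓ
series-rawSemiring = record
  { Carrier = Series
  ; _≈_     = _≗_
  ; _+_     = _⊕_
  ; _*_     = _⊛_
  ; 0#      = const 0ℚ
  ; 1#      = const 1ℚ
  }

open RawSemiringDefinitions series-rawSemiring using (product)
  renaming (_^_ to infixr 8 _⊛^_)

-- Composition f(g(t)), for g with zero constant term: then the terms
-- f_m g(t)^m with m > n do not contribute to the coefficient of tⁿ.
_⊚_ : Series → Series → Series
(f ⊚ g) n = ∑[ m ≤ n ] (f (toℕ m) * (g ⊛^ toℕ m) n)

-- Quotient f(t)/g(t) of two series with zero constant term, the linear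
-- coefficient of g being nonzero. The leading coefficient of the quotient
-- is c = f₁/g₁, and the remaining ones are those of ((f - c g)/t)/g.
_⊘_ : (f g : Series) → .{{NonZero (g 1)}} → Series
(f ⊘ g) zero    = f 1 ÷ g 1
(f ⊘ g) (suc n) = ((λ m → f (suc m) - f 1 ÷ g 1 * g (suc m)) ⊘ g) n

⊘-⊛ : (f g : Series) .{{_ : NonZero (g 1)}} → f 0 ≡ 0ℚ → g 0 ≡ 0ℚ →
      (f ⊘ g) ⊛ g ≗ f
⊘-⊛ f g f₀ g₀ zero = begin
  f 1 ÷ g 1 * g 0 + 0ℚ  ≡⟨ +-identityʳ _ ⟩
  f 1 ÷ g 1 * g 0       ≡⟨ cong (f 1 ÷ g 1 *_) g₀ ⟩
  f 1 ÷ g 1 * 0ℚ        ≡⟨ *-zeroʳ (f 1 ÷ g 1) ⟩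
  0ℚ                    ≡⟨ f₀ ⟨
  f 0                   ∎
  where open ≡-Reasoning
⊘-⊛ f g f₀ g₀ (suc n) = begin
  a + (f′ ⊘ g ⊛ g) n
    ≡⟨ cong (λ z → a + z) (⊘-⊛ f′ g f₁-cg₁ g₀ n) ⟩
  a + (f (suc n) - a)    ≡⟨ cong (λ z → a + z) (+-comm (f (suc n)) (- a)) ⟩
  a + (- a + f (suc n))  ≡⟨ +-assoc a (- a) (f (suc n)) ⟨
  a - a + f (suc n)      ≡⟨ cong (_+ f (suc n)) (+-inverseʳ a) ⟩
  0ℚ + f (suc n)         ≡⟨ +-identityˡ (f (suc n)) ⟩
  f (suc n)              ∎
  where
  open ≡-Reasoning
  c = f 1 ÷ g 1
  a = c * g (suc n)
  f′ : Series
  f′ m = f (suc m) - c * g (suc m)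
  f₁-cg₁ : f 1 - c * g 1 ≡ 0ℚ
  f₁-cg₁ = begin
    f 1 - c * g 1                  ≡⟨ cong (λ z → f 1 - z) (*-assoc (f 1) (1/ g 1) (g 1)) ⟩
    f 1 - f 1 * (1/ g 1 * g 1)     ≡⟨ cong (λ z → f 1 - f 1 * z) (*-inverseˡ (g 1)) ⟩
    f 1 - f 1 * 1ℚ                 ≡⟨ cong (λ z → f 1 - z) (*-identityʳ (f 1)) ⟩
    f 1 - f 1                      ≡⟨ +-inverseʳ (f 1) ⟩
    0ℚ                             ∎

-- e^{xt}
exp : ℚ → Series
exp x n = x ^ n * (+ 1 / (n !)) {{n !≢0}}

Li : ℤ → Series
Li p zero    = 0ℚ
Li p (suc n) = invPow p (suc n)

-- 1 - e^{-t}
1-exp⁻ : Series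
1-exp⁻ = const 1ℚ ⊖ exp (- 1ℚ)

Li⊘-⊛ : (p : ℤ) → ((Li p ⊚ 1-exp⁻) ⊘ 1-exp⁻) ⊛ 1-exp⁻ ≗ Li p ⊚ 1-exp⁻
Li⊘-⊛ p = ⊘-⊛ (Li p ⊚ 1-exp⁻) 1-exp⁻ refl refl

polyBernoulliGF : ℤ → ℚ → Series
polyBernoulliGF p x = ((Li p ⊚ 1-exp⁻) ⊘ 1-exp⁻) ⊛ exp x

-- B p n x is B_n^{(p)}(x), as a polynomial function on ℚ.
B : ℤ → ℕ → ℚ → ℚ
B p n x = + (n !) / 1 * polyBernoulliGF p x n

-- The polynomial (x + r)(x + r + 1)⋯(x + r + n - 1).
risingFactorial : (r n : ℕ) → Series
risingFactorial r n = product {n} λ i → X ⊕ const (+ (r ℕ.+ toℕ i) / 1)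

-- rStirling₁ r n k is [n+r, k+r]_r, with both entries shifted down by r.
rStirling₁ : (r n k : ℕ) → ℚ
rStirling₁ r n k = risingFactorial r n k

{-# OPTIONS --safe #-}

-- Put u = 1 - e⁻ᵗ and D = d/dt. As B_k is the k-th derivative at 0, the sum applies
-- the operator (D + r)(D + r + 1)⋯(D + r + n - 1) to e^{qt} A(u) at t = 0,
-- where A(u) = Li_p(u)/u. As u′ = 1 - u, one has
--   (D + r)(e^{qt} A(u)) = e^{qt} (θ_s A)(u),  θ_s A = (1 - u) A′ + s A,  s = q + r.
-- The s-fold partial sums Σˢ of coefficients, i.e. division by (1 - u)ˢ, satisfy
-- (Σˢ⁺¹ θ_s A)_n = (n + 1) (Σˢ A)_{n+1}, because
-- (1 - u)⁻ˢ⁻¹ θ_s A is the derivative of (1 - u)⁻ˢ A. Hence, by induction on n,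
-- the value is n! (Σˢ A)_n, which is n! H_{n+1}^{(p,s)}.

module Submission where

open import Defs
open import Algebra.Bundles using (CommutativeRing)
import Algebra.Definitions.RawSemiring as RawSemiringDefinitions
import Algebra.Properties.Semiring.Sum as SemiringSum
open import Data.Fin.Base as Fin using (Fin; toℕ)
open import Data.Fin.Properties using (toℕ-inject₁; toℕ-fromℕ)
open import Data.Integer.Base as ℤ using (ℤ; +_; 0ℤ; ∣_∣)
import Data.Integer.Properties as ℤ
open import Data.Nat.Base as ℕ using (ℕ; zero; suc; pred; _∸_; _!; z≤n; s≤s)
import Data.Nat.Coprimality as Coprimality
import Data.Nat.Properties as ℕ
open import Data.Rational.Base hiding (∣_∣)
open import Data.Rational.Properties
open import Data.Rational.Solver using (module +-*-Solver)
import Data.Rational.Unnormalised.Base as ℚᵘ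
import Data.Rational.Unnormalised.Properties as ℚᵘ
open import Function.Base using (_∘_)
open import Relation.Binary.PropositionalEquality

open +-*-Solver using (solve; _:=_; _:+_; _:*_; _:-_; con)
open RawSemiringDefinitions +-*-rawSemiring using (_^_)
open RawSemiringDefinitions series-rawSemiring using (product)
  renaming (_^_ to infixr 8 _⊛^_)
open SemiringSum (CommutativeRing.semiring +-*-commutativeRing)
  using (sum-cong-≗; sum-init-last; ∑-distrib-+; ∑-comm; *-distribˡ-sum)
open ≡-Reasoning

-- Casts to ℚ

fromℤ : ℤ → ℚ
fromℤ i = i / 1

fromℕ : ℕ → ℚ
fromℕ n = fromℤ (+ n)

-- The reduced form is built directly: `_+_` and `_*_` on ℚ compute only on constructors, while
-- `fromℤ` is stuck on the gcd normalisation for a variable `i`.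
integer : ℤ → ℚ
integer i = mkℚ i 0 (Coprimality.sym (Coprimality.1-coprimeTo ∣ i ∣))

fromℤ≡integer : ∀ i → fromℤ i ≡ integer i
fromℤ≡integer i = ↥p/↧p≡p (integer i)

fromℤ-+ : ∀ i j → fromℤ i + fromℤ j ≡ fromℤ (i ℤ.+ j)
fromℤ-+ i j = begin
  fromℤ i + fromℤ j                ≡⟨ cong₂ _+_ (fromℤ≡integer i) (fromℤ≡integer j) ⟩
  integer i + integer j            ≡⟨⟩
  fromℤ (i ℤ.* ℤ.1ℤ ℤ.+ j ℤ.* ℤ.1ℤ)  ≡⟨ cong₂ (λ a b → fromℤ (a ℤ.+ b)) (ℤ.*-identityʳ i) (ℤ.*-identityʳ j) ⟩
  fromℤ (i ℤ.+ j)                  ∎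

fromℤ-* : ∀ i j → fromℤ i * fromℤ j ≡ fromℤ (i ℤ.* j)
fromℤ-* i j = cong₂ _*_ (fromℤ≡integer i) (fromℤ≡integer j)

fromℕ-+ : ∀ m n → fromℕ (m ℕ.+ n) ≡ fromℕ m + fromℕ n
fromℕ-+ m n = sym (fromℤ-+ (+ m) (+ n))

fromℕ-* : ∀ m n → fromℕ (m ℕ.* n) ≡ fromℕ m * fromℕ n
fromℕ-* m n = sym (trans (fromℤ-* (+ m) (+ n)) (cong fromℤ (sym (ℤ.pos-* m n))))

fromℕ-suc : ∀ n → fromℕ (suc n) ≡ 1ℚ + fromℕ n
fromℕ-suc = fromℕ-+ 1

1/n*n : ∀ n .{{_ : ℕ.NonZero n}} → (+ 1 / n) * fromℕ n ≡ 1ℚ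
1/n*n (suc n) = toℚᵘ-injective (ℚᵘ.≃-trans (toℚᵘ-homo-* (+ 1 / suc n) (fromℕ (suc n)))
  (ℚᵘ.≃-trans
    (ℚᵘ.*-cong (toℚᵘ-fromℚᵘ (ℚᵘ.mkℚᵘ (+ 1) n)) (toℚᵘ-fromℚᵘ (ℚᵘ.mkℚᵘ (+ suc n) 0)))
    (ℚᵘ.*-inverseˡ (ℚᵘ.mkℚᵘ (+ suc n) 0))))

1/n! : ℕ → ℚ
1/n! n = (+ 1 / (n !)) {{ℕ._!≢0 n}}

1/n!*n! : ∀ n → 1/n! n * fromℕ (n !) ≡ 1ℚ
1/n!*n! n = 1/n*n (n !) {{ℕ._!≢0 n}}

1/n!-suc : ∀ n → fromℕ (suc n) * 1/n! (suc n) ≡ 1/n! n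
1/n!-suc n = begin
  s * y                ≡⟨ *-identityʳ (s * y) ⟨
  s * y * 1ℚ           ≡⟨ cong (s * y *_) (1/n!*n! n) ⟨
  s * y * (x * f)      ≡⟨ solve 4 (λ s y x f → s :* y :* (x :* f) := (y :* (s :* f)) :* x) refl s y x f ⟩
  (y * (s * f)) * x    ≡⟨ cong (λ z → (y * z) * x) (fromℕ-* (suc n) (n !)) ⟨
  (y * fromℕ (suc n !)) * x  ≡⟨ cong (_* x) (1/n!*n! (suc n)) ⟩
  1ℚ * x               ≡⟨ *-identityˡ x ⟩
  x                    ∎
  where
  s = fromℕ (suc n)
  f = fromℕ (n !)
  x = 1/n! n
  y = 1/n! (suc n)

-- Sums over initial segments of ℕ

∑< : ℕ → Series → ℚ
∑< n f = ∑[ k < n ] f (toℕ k)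

∑<-cong : ∀ n {f g : Series} → f ≗ g → ∑< n f ≡ ∑< n g
∑<-cong n f≗g = sum-cong-≗ {n} (λ k → f≗g (toℕ k))

∑<-last : ∀ n f → ∑< (suc n) f ≡ ∑< n f + f n
∑<-last n f = trans (sum-init-last {n} (λ k → f (toℕ k)))
  (cong₂ _+_ (sum-cong-≗ {n} (λ k → cong f (toℕ-inject₁ k))) (cong f (toℕ-fromℕ n)))

∑<-+ : ∀ n f g → ∑< n (f ⊕ g) ≡ ∑< n f + ∑< n g
∑<-+ n f g = ∑-distrib-+ {n} (λ k → f (toℕ k)) (λ k → g (toℕ k))

∑<-* : ∀ n c f → ∑< n (λ k → c * f k) ≡ c * ∑< n f
∑<-* n c f = sym (*-distribˡ-sum {n} c (λ k → f (toℕ k)))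

∑<-extend : ∀ {k n f} → k ℕ.≤ n → (∀ m → k ℕ.≤ m → f m ≡ 0ℚ) → ∑< k f ≡ ∑< n f
∑<-extend {zero} {zero} z≤n f≡0 = refl
∑<-extend {zero} {suc n} z≤n f≡0 =
  sym (cong₂ _+_ (f≡0 0 z≤n) (sym (∑<-extend {n = n} z≤n (λ m _ → f≡0 (suc m) z≤n))))
∑<-extend {suc k} {suc n} {f} (s≤s k≤n) f≡0 =
  cong (λ z → f 0 + z) (∑<-extend k≤n (λ m k≤m → f≡0 (suc m) (s≤s k≤m)))

-- Products of series

shift : Series → Series
shift f n = f (suc n)

infixr 8 _·_
_·_ : ℚ → Series → Series
(c · f) n = c * f n

⊛-cong : ∀ {f f′ g g′} → f ≗ f′ → g ≗ g′ → f ⊛ g ≗ f′ ⊛ g′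
⊛-cong f≗f′ g≗g′ n = ∑<-cong (suc n) (λ k → cong₂ _*_ (f≗f′ k) (g≗g′ (n ∸ k)))

⊛-congˡ : ∀ f {g g′} → g ≗ g′ → f ⊛ g ≗ f ⊛ g′
⊛-congˡ f = ⊛-cong {f} (λ _ → refl)

⊛-congʳ : ∀ {f f′} g → f ≗ f′ → f ⊛ g ≗ f′ ⊛ g
⊛-congʳ g f≗f′ = ⊛-cong {g = g} f≗f′ (λ _ → refl)

-- By definition a product unfolds at the constant term of its left factor. This is the mirror
-- image, and comparing the two unfoldings gives commutativity by induction.
⊛-sucʳ : ∀ f g n → (f ⊛ g) (suc n) ≡ f (suc n) * g 0 + (f ⊛ shift g) n
⊛-sucʳ f g zero = solve 4 (λ f₀ f₁ g₀ g₁ →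
  f₀ :* g₁ :+ (f₁ :* g₀ :+ con 0ℚ) := f₁ :* g₀ :+ (f₀ :* g₁ :+ con 0ℚ)) refl
  (f 0) (f 1) (g 0) (g 1)
⊛-sucʳ f g (suc n) = begin
  f 0 * g (2 ℕ.+ n) + (shift f ⊛ g) (suc n)
    ≡⟨ cong (λ z → f 0 * g (2 ℕ.+ n) + z) (⊛-sucʳ (shift f) g n) ⟩
  f 0 * g (2 ℕ.+ n) + (f (2 ℕ.+ n) * g 0 + (shift f ⊛ shift g) n)
    ≡⟨ solve 3 (λ x y z → x :+ (y :+ z) := y :+ (x :+ z)) refl
         (f 0 * g (2 ℕ.+ n)) (f (2 ℕ.+ n) * g 0) ((shift f ⊛ shift g) n) ⟩
  f (2 ℕ.+ n) * g 0 + (f ⊛ shift g) (suc n)  ∎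

⊛-comm : ∀ f g → f ⊛ g ≗ g ⊛ f
⊛-comm f g zero    = cong (_+ 0ℚ) (*-comm (f 0) (g 0))
⊛-comm f g (suc n) = begin
  f 0 * g (suc n) + (shift f ⊛ g) n  ≡⟨ cong₂ _+_ (*-comm (f 0) (g (suc n))) (⊛-comm (shift f) g n) ⟩
  g (suc n) * f 0 + (g ⊛ shift f) n  ≡⟨ ⊛-sucʳ g f n ⟨
  (g ⊛ f) (suc n)                    ∎

⊛-distribˡ-⊕ : ∀ f g h → f ⊛ (g ⊕ h) ≗ f ⊛ g ⊕ f ⊛ h
⊛-distribˡ-⊕ f g h n = trans
  (∑<-cong (suc n) (λ k → *-distribˡ-+ (f k) (g (n ∸ k)) (h (n ∸ k))))
  (∑<-+ (suc n) (λ k → f k * g (n ∸ k)) (λ k → f k * h (n ∸ k)))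

⊛-distribʳ-⊕ : ∀ f g h → (g ⊕ h) ⊛ f ≗ g ⊛ f ⊕ h ⊛ f
⊛-distribʳ-⊕ f g h n = trans
  (∑<-cong (suc n) (λ k → *-distribʳ-+ (f (n ∸ k)) (g k) (h k)))
  (∑<-+ (suc n) (λ k → g k * f (n ∸ k)) (λ k → h k * f (n ∸ k)))

·-⊛ : ∀ c f g → (c · f) ⊛ g ≗ c · (f ⊛ g)
·-⊛ c f g n = trans
  (∑<-cong (suc n) (λ k → *-assoc c (f k) (g (n ∸ k))))
  (∑<-* (suc n) c (λ k → f k * g (n ∸ k)))

⊛-· : ∀ c f g → f ⊛ (c · g) ≗ c · (f ⊛ g)
⊛-· c f g n = begin
  (f ⊛ (c · g)) n  ≡⟨ ⊛-comm f (c · g) n ⟩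
  ((c · g) ⊛ f) n  ≡⟨ ·-⊛ c g f n ⟩
  c * (g ⊛ f) n    ≡⟨ cong (c *_) (⊛-comm g f n) ⟩
  c * (f ⊛ g) n    ∎

⊛-vanishˡ : ∀ f g n → (∀ k → k ℕ.≤ n → f k ≡ 0ℚ) → (f ⊛ g) n ≡ 0ℚ
⊛-vanishˡ f g zero f≡0 = begin
  f 0 * g 0 + 0ℚ  ≡⟨ +-identityʳ _ ⟩
  f 0 * g 0       ≡⟨ cong (_* g 0) (f≡0 0 z≤n) ⟩
  0ℚ * g 0        ≡⟨ *-zeroˡ (g 0) ⟩
  0ℚ              ∎
⊛-vanishˡ f g (suc n) f≡0 = begin
  f 0 * g (suc n) + (shift f ⊛ g) n
    ≡⟨ cong₂ (λ x y → x * g (suc n) + y) (f≡0 0 z≤n)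
         (⊛-vanishˡ (shift f) g n (λ k k≤n → f≡0 (suc k) (s≤s k≤n))) ⟩
  0ℚ * g (suc n) + 0ℚ  ≡⟨ +-identityʳ _ ⟩
  0ℚ * g (suc n)       ≡⟨ *-zeroˡ (g (suc n)) ⟩
  0ℚ                   ∎

⊛-vanishʳ : ∀ f g n → (∀ k → k ℕ.≤ n → g k ≡ 0ℚ) → (f ⊛ g) n ≡ 0ℚ
⊛-vanishʳ f g n g≡0 = trans (⊛-comm f g n) (⊛-vanishˡ g f n g≡0)

⊛-identityˡ : ∀ f → const 1ℚ ⊛ f ≗ f
⊛-identityˡ f zero    = trans (+-identityʳ _) (*-identityˡ (f 0))
⊛-identityˡ f (suc n) = begin
  1ℚ * f (suc n) + (shift (const 1ℚ) ⊛ f) n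
    ≡⟨ cong₂ _+_ (*-identityˡ (f (suc n))) (⊛-vanishˡ (shift (const 1ℚ)) f n (λ _ _ → refl)) ⟩
  f (suc n) + 0ℚ  ≡⟨ +-identityʳ _ ⟩
  f (suc n)       ∎

-- Each factor `g` raises the order by at least one. All changes of the truncation bound in sums
-- over powers rest on this.
⊛^-vanish : ∀ g → g 0 ≡ 0ℚ → ∀ {n m} → n ℕ.< m → (g ⊛^ m) n ≡ 0ℚ
⊛^-vanish g g₀ {zero} {suc m} _ = begin
  g 0 * (g ⊛^ m) 0 + 0ℚ  ≡⟨ +-identityʳ _ ⟩
  g 0 * (g ⊛^ m) 0       ≡⟨ cong (_* (g ⊛^ m) 0) g₀ ⟩
  0ℚ * (g ⊛^ m) 0        ≡⟨ *-zeroˡ ((g ⊛^ m) 0) ⟩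
  0ℚ                     ∎
⊛^-vanish g g₀ {suc n} {suc m} (s≤s n<m) = begin
  g 0 * (g ⊛^ m) (suc n) + (shift g ⊛ (g ⊛^ m)) n
    ≡⟨ cong₂ (λ x y → x * (g ⊛^ m) (suc n) + y) g₀
         (⊛-vanishʳ (shift g) (g ⊛^ m) n (λ k k≤n → ⊛^-vanish g g₀ (ℕ.≤-<-trans k≤n n<m))) ⟩
  0ℚ * (g ⊛^ m) (suc n) + 0ℚ  ≡⟨ +-identityʳ _ ⟩
  0ℚ * (g ⊛^ m) (suc n)       ≡⟨ *-zeroˡ ((g ⊛^ m) (suc n)) ⟩
  0ℚ                          ∎

-- The coefficient of index `n ∸ k` of `A ⊚ g` is cut off at m = n - k. Since `g ⊛^ m` has order at
-- least m, all these cut-offs can be raised to the common bound n, and then the two summations are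
-- interchanged.
⊛-⊚ : ∀ f A g → g 0 ≡ 0ℚ → ∀ n →
      (f ⊛ (A ⊚ g)) n ≡ ∑< (suc n) (λ m → A m * (f ⊛ (g ⊛^ m)) n)
⊛-⊚ f A g g₀ n = begin
  ∑< (suc n) (λ k → f k * ∑< (suc (n ∸ k)) (term k))
    ≡⟨ ∑<-cong (suc n) (λ k → cong (f k *_)
         (∑<-extend (s≤s (ℕ.m∸n≤m n k)) (vanish k))) ⟩
  ∑< (suc n) (λ k → f k * ∑< (suc n) (term k))
    ≡⟨ ∑<-cong (suc n) (λ k → ∑<-* (suc n) (f k) (term k)) ⟨
  ∑< (suc n) (λ k → ∑< (suc n) (λ m → f k * term k m))
    ≡⟨ ∑-comm {suc n} {suc n} (λ k m → f (toℕ k) * term (toℕ k) (toℕ m)) ⟩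
  ∑< (suc n) (λ m → ∑< (suc n) (λ k → f k * term k m))
    ≡⟨ ∑<-cong (suc n) (λ m → trans
         (∑<-cong (suc n) (λ k → solve 3 (λ x y z → x :* (y :* z) := y :* (x :* z)) refl
                                   (f k) (A m) ((g ⊛^ m) (n ∸ k))))
         (∑<-* (suc n) (A m) (λ k → f k * (g ⊛^ m) (n ∸ k)))) ⟩
  ∑< (suc n) (λ m → A m * (f ⊛ (g ⊛^ m)) n)  ∎
  where
  term : ℕ → ℕ → ℚ
  term k m = A m * (g ⊛^ m) (n ∸ k)
  vanish : ∀ k m → suc (n ∸ k) ℕ.≤ m → term k m ≡ 0ℚ
  vanish k m n∸k<m = trans (cong (A m *_) (⊛^-vanish g g₀ n∸k<m)) (*-zeroʳ (A m))

-- Quotients of series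

⊘-cong : ∀ {f f′} g .{{_ : NonZero (g 1)}} → f ≗ f′ → f ⊘ g ≗ f′ ⊘ g
⊘-cong g f≗f′ zero    = cong (_÷ g 1) (f≗f′ 1)
⊘-cong g f≗f′ (suc n) = ⊘-cong g
  (λ m → cong₂ (λ x y → x - y ÷ g 1 * g (suc m)) (f≗f′ (suc m)) (f≗f′ 1)) n

-- The first quotient coefficient is `h 0`; subtracting `h 0 · g` and dividing by t leaves
-- `shift h ⊛ g`, so the recursion of `⊘` runs through the coefficients of `h`.
⊛-⊘ : ∀ h g .{{_ : NonZero (g 1)}} → g 0 ≡ 0ℚ → (h ⊛ g) ⊘ g ≗ h
⊛-⊘ h g g₀ zero = begin
  (h 0 * g 1 + (h 1 * g 0 + 0ℚ)) * 1/ g 1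
    ≡⟨ cong (λ z → (h 0 * g 1 + (h 1 * z + 0ℚ)) * 1/ g 1) g₀ ⟩
  (h 0 * g 1 + (h 1 * 0ℚ + 0ℚ)) * 1/ g 1
    ≡⟨ solve 4 (λ a b c d → (a :* b :+ (c :* con 0ℚ :+ con 0ℚ)) :* d := a :* (b :* d)) refl
         (h 0) (g 1) (h 1) (1/ g 1) ⟩
  h 0 * (g 1 * 1/ g 1)  ≡⟨ cong (h 0 *_) (*-inverseʳ (g 1)) ⟩
  h 0 * 1ℚ              ≡⟨ *-identityʳ (h 0) ⟩
  h 0                   ∎
⊛-⊘ h g g₀ (suc n) = trans (⊘-cong g tail n) (⊛-⊘ (shift h) g g₀ n)
  where
  tail : ∀ m → (h ⊛ g) (suc m) - (h ⊛ g) 1 ÷ g 1 * g (suc m) ≡ (shift h ⊛ g) m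
  tail m = begin
    (h ⊛ g) (suc m) - (h ⊛ g) 1 ÷ g 1 * g (suc m)
      ≡⟨ cong (λ z → (h ⊛ g) (suc m) - z * g (suc m)) (⊛-⊘ h g g₀ zero) ⟩
    h 0 * g (suc m) + (shift h ⊛ g) m - h 0 * g (suc m)
      ≡⟨ solve 2 (λ x y → x :+ y :- x := y) refl (h 0 * g (suc m)) ((shift h ⊛ g) m) ⟩
    (shift h ⊛ g) m  ∎

-- Derivatives

deriv : Series → Series
deriv f n = fromℕ (suc n) * f (suc n)

-- The operator t d/dt, whose shift is `deriv` by definition. It keeps indices in place, so the
-- Leibniz rule is proved for it first and then carried over to `deriv`.
euler : Series → Series
euler f n = fromℕ n * f n

shift-euler : ∀ f → shift (euler f) ≗ euler (shift f) ⊕ shift f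
shift-euler f n = trans (cong (_* f (suc n)) (fromℕ-suc n))
  (solve 2 (λ x y → (con 1ℚ :+ x) :* y := x :* y :+ y) refl (fromℕ n) (f (suc n)))

euler-⊛ : ∀ f g → euler (f ⊛ g) ≗ euler f ⊛ g ⊕ f ⊛ euler g
euler-⊛ f g zero = solve 2 (λ x y → con 0ℚ :* (x :* y :+ con 0ℚ)
  := con 0ℚ :* x :* y :+ con 0ℚ :+ (x :* (con 0ℚ :* y) :+ con 0ℚ)) refl (f 0) (g 0)
euler-⊛ f g (suc n) = begin
  N * (f 0 * g (suc n) + c)
    ≡⟨ *-distribˡ-+ N (f 0 * g (suc n)) c ⟩
  N * (f 0 * g (suc n)) + N * c
    -- Only the factor in front of `c` is split as 1 + n: the part n feeds the induction hypothesis
    -- for `shift f`, and the remaining `c` is the extra summand from `shift-euler`.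
    ≡⟨ cong (λ z → N * (f 0 * g (suc n)) + z * c) (fromℕ-suc n) ⟩
  N * (f 0 * g (suc n)) + (1ℚ + fromℕ n) * c
    ≡⟨ solve 5 (λ N x y n c → N :* (x :* y) :+ (con 1ℚ :+ n) :* c := N :* (x :* y) :+ (n :* c :+ c)) refl
         N (f 0) (g (suc n)) (fromℕ n) c ⟩
  N * (f 0 * g (suc n)) + (fromℕ n * c + c)
    ≡⟨ cong (λ z → N * (f 0 * g (suc n)) + (z + c)) (euler-⊛ (shift f) g n) ⟩
  N * (f 0 * g (suc n)) + (a + b + c)
    ≡⟨ solve 6 (λ N x y a b c → N :* (x :* y) :+ (a :+ b :+ c)
         := con 0ℚ :* x :* y :+ (a :+ c) :+ (x :* (N :* y) :+ b)) refl
         N (f 0) (g (suc n)) a b c ⟩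
  0ℚ * f 0 * g (suc n) + (a + c) + (f 0 * (N * g (suc n)) + b)
    ≡⟨ cong (λ z → 0ℚ * f 0 * g (suc n) + z + (f 0 * (N * g (suc n)) + b))
         (trans (⊛-congʳ g (shift-euler f) n) (⊛-distribʳ-⊕ g (euler (shift f)) (shift f) n)) ⟨
  (euler f ⊛ g) (suc n) + (f ⊛ euler g) (suc n)  ∎
  where
  N = fromℕ (suc n)
  a = (euler (shift f) ⊛ g) n
  b = (shift f ⊛ euler g) n
  c = (shift f ⊛ g) n

deriv-⊛ : ∀ f g → deriv (f ⊛ g) ≗ deriv f ⊛ g ⊕ f ⊛ deriv g
deriv-⊛ f g n = begin
  euler (f ⊛ g) (suc n)                          ≡⟨ euler-⊛ f g (suc n) ⟩
  (euler f ⊛ g) (suc n) + (f ⊛ euler g) (suc n)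
    ≡⟨ cong (λ z → (euler f ⊛ g) (suc n) + z) (⊛-sucʳ f (euler g) n) ⟩
  0ℚ * f 0 * g (suc n) + (deriv f ⊛ g) n + (f (suc n) * (0ℚ * g 0) + (f ⊛ deriv g) n)
    ≡⟨ solve 6 (λ x y z w a b → con 0ℚ :* x :* y :+ a :+ (z :* (con 0ℚ :* w) :+ b) := a :+ b) refl
         (f 0) (g (suc n)) (f (suc n)) (g 0) ((deriv f ⊛ g) n) ((f ⊛ deriv g) n) ⟩
  (deriv f ⊛ g) n + (f ⊛ deriv g) n  ∎

deriv-exp : ∀ x → deriv (exp x) ≗ x · exp x
deriv-exp x n = begin
  fromℕ (suc n) * (x * x ^ n * 1/n! (suc n))
    ≡⟨ solve 4 (λ s x y z → s :* (x :* y :* z) := x :* (y :* (s :* z))) refl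
         (fromℕ (suc n)) x (x ^ n) (1/n! (suc n)) ⟩
  x * (x ^ n * (fromℕ (suc n) * 1/n! (suc n)))
    ≡⟨ cong (λ z → x * (x ^ n * z)) (1/n!-suc n) ⟩
  x * (x ^ n * 1/n! n)  ∎

deriv-1-exp⁻ : deriv 1-exp⁻ ≗ const 1ℚ ⊖ 1-exp⁻
deriv-1-exp⁻ n = begin
  N * (0ℚ - e (suc n))
    ≡⟨ solve 2 (λ N x → N :* (con 0ℚ :- x) := con 0ℚ :- N :* x) refl N (e (suc n)) ⟩
  0ℚ - N * e (suc n)     ≡⟨ cong (λ z → 0ℚ - z) (deriv-exp (- 1ℚ) n) ⟩
  0ℚ - (- 1ℚ) * e n
    ≡⟨ solve 2 (λ c x → con 0ℚ :- con (- 1ℚ) :* x := c :- (c :- x)) refl (const 1ℚ n) (e n) ⟩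
  const 1ℚ n - (const 1ℚ n - e n)  ∎
  where
  N = fromℕ (suc n)
  e = exp (- 1ℚ)

-- With u′ = 1 - u, the power rule gives m u^(m-1) (1 - u). At m = 0 the value of `pred` is harmless
-- because of the factor m.
deriv-1-exp⁻^ : ∀ m → deriv (1-exp⁻ ⊛^ m)
              ≗ fromℕ m · (1-exp⁻ ⊛^ pred m ⊕ (- 1ℚ) · (1-exp⁻ ⊛^ m))
deriv-1-exp⁻^ zero    n = trans (*-zeroʳ (fromℕ (suc n)))
  (sym (*-zeroˡ (const 1ℚ n + (- 1ℚ) * const 1ℚ n)))
deriv-1-exp⁻^ (suc m) n = begin
  deriv (u ⊛ P) n
    ≡⟨ deriv-⊛ u P n ⟩
  (deriv u ⊛ P) n + (u ⊛ deriv P) n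
    ≡⟨ cong₂ _+_ (⊛-congʳ P (λ k → trans (deriv-1-exp⁻ k)
                   (solve 2 (λ x y → x :- y := x :+ con (- 1ℚ) :* y) refl (const 1ℚ k) (u k))) n)
                 (⊛-congˡ u (deriv-1-exp⁻^ m) n) ⟩
  ((const 1ℚ ⊕ (- 1ℚ) · u) ⊛ P) n + (u ⊛ (fromℕ m · (P′ ⊕ (- 1ℚ) · P))) n
    ≡⟨ cong₂ _+_
         (trans (⊛-distribʳ-⊕ P (const 1ℚ) ((- 1ℚ) · u) n)
                (cong₂ _+_ (⊛-identityˡ P n) (·-⊛ (- 1ℚ) u P n)))
         (trans (⊛-· (fromℕ m) u (P′ ⊕ (- 1ℚ) · P) n)
                (cong (fromℕ m *_) (trans (⊛-distribˡ-⊕ u P′ ((- 1ℚ) · P) n)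
                  (cong (λ z → (u ⊛ P′) n + z) (⊛-· (- 1ℚ) u P n))))) ⟩
  P n + (- 1ℚ) * (u ⊛ P) n + fromℕ m * ((u ⊛ P′) n + (- 1ℚ) * (u ⊛ P) n)
    ≡⟨ solve 4 (λ p q m r → p :+ con (- 1ℚ) :* q :+ m :* (r :+ con (- 1ℚ) :* q)
         := p :+ con (- 1ℚ) :* q :+ (m :* r :+ m :* (con (- 1ℚ) :* q))) refl
         (P n) ((u ⊛ P) n) (fromℕ m) ((u ⊛ P′) n) ⟩
  P n + (- 1ℚ) * (u ⊛ P) n + (fromℕ m * (u ⊛ P′) n + fromℕ m * ((- 1ℚ) * (u ⊛ P) n))
    ≡⟨ cong (λ z → P n + (- 1ℚ) * (u ⊛ P) n + (z + fromℕ m * ((- 1ℚ) * (u ⊛ P) n))) (m*u⊛P′ m) ⟩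
  P n + (- 1ℚ) * (u ⊛ P) n + (fromℕ m * P n + fromℕ m * ((- 1ℚ) * (u ⊛ P) n))
    ≡⟨ solve 3 (λ p q m → p :+ con (- 1ℚ) :* q :+ (m :* p :+ m :* (con (- 1ℚ) :* q))
         := (con 1ℚ :+ m) :* (p :+ con (- 1ℚ) :* q)) refl (P n) ((u ⊛ P) n) (fromℕ m) ⟩
  (1ℚ + fromℕ m) * (P n + (- 1ℚ) * (u ⊛ P) n)
    ≡⟨ cong (_* (P n + (- 1ℚ) * (u ⊛ P) n)) (fromℕ-suc m) ⟨
  fromℕ (suc m) * (P n + (- 1ℚ) * (u ⊛ P) n)  ∎
  where
  u = 1-exp⁻
  P = u ⊛^ m
  P′ = u ⊛^ pred m
  -- Without the factor m this fails at m = 0, where the left product would be u and the right one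
  -- 1.
  m*u⊛P′ : ∀ m → fromℕ m * (u ⊛ (u ⊛^ pred m)) n ≡ fromℕ m * (u ⊛^ m) n
  m*u⊛P′ zero    = trans (*-zeroˡ ((u ⊛ (u ⊛^ 0)) n)) (sym (*-zeroˡ ((u ⊛^ 0) n)))
  m*u⊛P′ (suc m) = refl

-- The operator (1 - u) d/du + c.
θ : ℚ → Series → Series
θ c A m = fromℕ (suc m) * A (suc m) + (c - fromℕ m) * A m

-- The action of d/dt on e^{qt} A(u)

exp⊛^ : ℚ → ℕ → Series
exp⊛^ q m = exp q ⊛ (1-exp⁻ ⊛^ m)

exp⊛⊚ : ℚ → Series → Series
exp⊛⊚ q A = exp q ⊛ (A ⊚ 1-exp⁻)

-- The case A = u^m of `deriv-exp⊛⊚`, since θ_q u^m = m u^(m-1) + (q - m) u^m.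
deriv-exp⊛^ : ∀ q m n → deriv (exp⊛^ q m) n
            ≡ (q - fromℕ m) * exp⊛^ q m n + fromℕ m * exp⊛^ q (pred m) n
deriv-exp⊛^ q m n = begin
  deriv (exp q ⊛ P) n
    ≡⟨ deriv-⊛ (exp q) P n ⟩
  (deriv (exp q) ⊛ P) n + (exp q ⊛ deriv P) n
    ≡⟨ cong₂ _+_ (trans (⊛-congʳ P (deriv-exp q) n) (·-⊛ q (exp q) P n))
         (trans (⊛-congˡ (exp q) (deriv-1-exp⁻^ m) n)
         (trans (⊛-· (fromℕ m) (exp q) (P′ ⊕ (- 1ℚ) · P) n)
                (cong (fromℕ m *_) (trans (⊛-distribˡ-⊕ (exp q) P′ ((- 1ℚ) · P) n)
                  (cong (λ z → (exp q ⊛ P′) n + z) (⊛-· (- 1ℚ) (exp q) P n)))))) ⟩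
  q * (exp q ⊛ P) n + fromℕ m * ((exp q ⊛ P′) n + (- 1ℚ) * (exp q ⊛ P) n)
    ≡⟨ solve 4 (λ q m x y → q :* x :+ m :* (y :+ con (- 1ℚ) :* x) := (q :- m) :* x :+ m :* y) refl
         q (fromℕ m) ((exp q ⊛ P) n) ((exp q ⊛ P′) n) ⟩
  (q - fromℕ m) * (exp q ⊛ P) n + fromℕ m * (exp q ⊛ P′) n  ∎
  where
  P = 1-exp⁻ ⊛^ m
  P′ = 1-exp⁻ ⊛^ pred m

exp⊛^-vanish : ∀ q {n m} → n ℕ.< m → exp⊛^ q m n ≡ 0ℚ
exp⊛^-vanish q {n} {m} n<m = ⊛-vanishʳ (exp q) (1-exp⁻ ⊛^ m) n
  (λ k k≤n → ⊛^-vanish 1-exp⁻ refl (ℕ.≤-<-trans k≤n n<m))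

exp⊛⊚-expand : ∀ q A n → exp⊛⊚ q A n ≡ ∑< (suc n) (λ m → A m * exp⊛^ q m n)
exp⊛⊚-expand q A n = ⊛-⊚ (exp q) A 1-exp⁻ refl n

-- Differentiating termwise, e^{qt} u^m arises from the m-th term with weight q - m and from the
-- (m+1)-st with weight m + 1; together these give the coefficient `θ q A m`.
deriv-exp⊛⊚ : ∀ q A → deriv (exp⊛⊚ q A) ≗ exp⊛⊚ q (θ q A)
deriv-exp⊛⊚ q A n = begin
  N * exp⊛⊚ q A (suc n)
    ≡⟨ cong (N *_) (exp⊛⊚-expand q A (suc n)) ⟩
  N * ∑< (2 ℕ.+ n) (λ m → A m * exp⊛^ q m (suc n))
    ≡⟨ ∑<-* (2 ℕ.+ n) N (λ m → A m * exp⊛^ q m (suc n)) ⟨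
  ∑< (2 ℕ.+ n) (λ m → N * (A m * exp⊛^ q m (suc n)))
    ≡⟨ ∑<-cong (2 ℕ.+ n) term ⟩
  ∑< (2 ℕ.+ n) (a ⊕ b)
    ≡⟨ ∑<-+ (2 ℕ.+ n) a b ⟩
  ∑< (2 ℕ.+ n) a + ∑< (2 ℕ.+ n) b
    -- Both sums lose one term: the last one of `a` contains u^(n+1), which has no coefficient at n,
    -- and the first one of `b` carries the factor 0.
    ≡⟨ cong₂ _+_ a-last b-first ⟩
  ∑< (suc n) a + ∑< (suc n) (shift b)
    ≡⟨ ∑<-+ (suc n) a (shift b) ⟨
  ∑< (suc n) (a ⊕ shift b)
    ≡⟨ ∑<-cong (suc n) (λ m → solve 4 (λ x y z w → x :* y :+ z :* w :* y := (z :* w :+ x) :* y) refl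
         ((q - fromℕ m) * A m) (exp⊛^ q m n) (fromℕ (suc m)) (A (suc m))) ⟩
  ∑< (suc n) (λ m → θ q A m * exp⊛^ q m n)
    ≡⟨ exp⊛⊚-expand q (θ q A) n ⟨
  exp⊛⊚ q (θ q A) n  ∎
  where
  N = fromℕ (suc n)
  a b : Series
  a m = (q - fromℕ m) * A m * exp⊛^ q m n
  b m = fromℕ m * A m * exp⊛^ q (pred m) n
  term : ∀ m → N * (A m * exp⊛^ q m (suc n)) ≡ a m + b m
  term m = begin
    N * (A m * exp⊛^ q m (suc n))
      ≡⟨ solve 3 (λ x y z → x :* (y :* z) := y :* (x :* z)) refl N (A m) (exp⊛^ q m (suc n)) ⟩
    A m * deriv (exp⊛^ q m) n
      ≡⟨ cong (A m *_) (deriv-exp⊛^ q m n) ⟩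
    A m * ((q - fromℕ m) * exp⊛^ q m n + fromℕ m * exp⊛^ q (pred m) n)
      ≡⟨ solve 5 (λ y c e m e′ → y :* (c :* e :+ m :* e′) := c :* y :* e :+ m :* y :* e′) refl
           (A m) (q - fromℕ m) (exp⊛^ q m n) (fromℕ m) (exp⊛^ q (pred m) n) ⟩
    a m + b m  ∎
  a-last : ∑< (2 ℕ.+ n) a ≡ ∑< (suc n) a
  a-last = begin
    ∑< (2 ℕ.+ n) a            ≡⟨ ∑<-last (suc n) a ⟩
    ∑< (suc n) a + a (suc n)  ≡⟨ cong (λ z → ∑< (suc n) a + (q - N) * A (suc n) * z)
                                   (exp⊛^-vanish q (ℕ.n<1+n n)) ⟩
    ∑< (suc n) a + (q - N) * A (suc n) * 0ℚ
      ≡⟨ solve 2 (λ x y → x :+ y :* con 0ℚ := x) refl (∑< (suc n) a) ((q - N) * A (suc n)) ⟩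
    ∑< (suc n) a              ∎
  b-first : ∑< (2 ℕ.+ n) b ≡ ∑< (suc n) (shift b)
  b-first = solve 3 (λ x y z → con 0ℚ :* x :* y :+ z := z) refl
    (A 0) (exp⊛^ q 0 n) (∑< (suc n) (shift b))

exp⊛⊚-⊕ : ∀ q A c A′ n → exp⊛⊚ q A n + c * exp⊛⊚ q A′ n ≡ exp⊛⊚ q (A ⊕ c · A′) n
exp⊛⊚-⊕ q A c A′ n = begin
  exp⊛⊚ q A n + c * exp⊛⊚ q A′ n
    ≡⟨ cong₂ (λ x y → x + c * y) (exp⊛⊚-expand q A n) (exp⊛⊚-expand q A′ n) ⟩
  ∑< (suc n) a + c * ∑< (suc n) a′
    ≡⟨ cong (λ z → ∑< (suc n) a + z) (∑<-* (suc n) c a′) ⟨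
  ∑< (suc n) a + ∑< (suc n) (c · a′)
    ≡⟨ ∑<-+ (suc n) a (c · a′) ⟨
  ∑< (suc n) (a ⊕ c · a′)
    ≡⟨ ∑<-cong (suc n) (λ m → solve 4 (λ x y c z → x :* y :+ c :* (z :* y) := (x :+ c :* z) :* y) refl
         (A m) (exp⊛^ q m n) c (A′ m)) ⟩
  ∑< (suc n) (λ m → (A ⊕ c · A′) m * exp⊛^ q m n)
    ≡⟨ exp⊛⊚-expand q (A ⊕ c · A′) n ⟨
  exp⊛⊚ q (A ⊕ c · A′) n  ∎
  where
  a a′ : Series
  a m = A m * exp⊛^ q m n
  a′ m = A′ m * exp⊛^ q m n

exp⊛⊚-cong : ∀ q {A A′} → A ≗ A′ → exp⊛⊚ q A ≗ exp⊛⊚ q A′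
exp⊛⊚-cong q A≗A′ = ⊛-congˡ (exp q) (λ n → ∑<-cong (suc n) (λ m → cong (_* (1-exp⁻ ⊛^ m) n) (A≗A′ m)))

deriv+-exp⊛⊚ : ∀ q a A n → deriv (exp⊛⊚ q A) n + a * exp⊛⊚ q A n ≡ exp⊛⊚ q (θ (q + a) A) n
deriv+-exp⊛⊚ q a A n = begin
  deriv (exp⊛⊚ q A) n + a * exp⊛⊚ q A n  ≡⟨ cong (_+ a * exp⊛⊚ q A n) (deriv-exp⊛⊚ q A n) ⟩
  exp⊛⊚ q (θ q A) n + a * exp⊛⊚ q A n    ≡⟨ exp⊛⊚-⊕ q (θ q A) a A n ⟩
  exp⊛⊚ q (θ q A ⊕ a · A) n
    ≡⟨ exp⊛⊚-cong q (λ m → solve 5 (λ x q m y a → x :+ (q :- m) :* y :+ a :* y := x :+ (q :+ a :- m) :* y)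
         refl (fromℕ (suc m) * A (suc m)) q (fromℕ m) (A m) a) n ⟩
  exp⊛⊚ q (θ (q + a) A) n  ∎

-- Iterated partial sums

-- Unfolds at the last term, whereas `∑<` unfolds at the first; this suits the telescoping
-- inductions on n.
partialSum : Series → Series
partialSum A zero    = A 0
partialSum A (suc n) = partialSum A n + A (suc n)

partialSums : ℕ → Series → Series
partialSums zero    A = A
partialSums (suc s) A = partialSum (partialSums s A)

partialSum≡∑ : ∀ A n → partialSum A n ≡ ∑< (suc n) A
partialSum≡∑ A zero    = sym (+-identityʳ (A 0))
partialSum≡∑ A (suc n) =
  trans (cong (_+ A (suc n)) (partialSum≡∑ A n)) (sym (∑<-last (suc n) A))

partialSum-cong : ∀ {A A′} → A ≗ A′ → partialSum A ≗ partialSum A′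
partialSum-cong A≗A′ zero    = A≗A′ 0
partialSum-cong A≗A′ (suc n) = cong₂ _+_ (partialSum-cong A≗A′ n) (A≗A′ (suc n))

partialSums-cong : ∀ s {A A′} → A ≗ A′ → partialSums s A ≗ partialSums s A′
partialSums-cong zero    A≗A′ = A≗A′
partialSums-cong (suc s) A≗A′ = partialSum-cong (partialSums-cong s A≗A′)

partialSums-partialSum : ∀ s A → partialSums s (partialSum A) ≗ partialSum (partialSums s A)
partialSums-partialSum zero    A n = refl
partialSums-partialSum (suc s) A   = partialSum-cong (partialSums-partialSum s A)

-- The differences (m + 1) A_{m+1} - m A_m telescope.
partialSum-θ : ∀ c A n → partialSum (θ c A) n ≡ fromℕ (suc n) * A (suc n) + c * partialSum A n
partialSum-θ c A zero = solve 3 (λ x c y → x :+ (c :- con 0ℚ) :* y := x :+ c :* y) refl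
  (fromℕ 1 * A 1) c (A 0)
partialSum-θ c A (suc n) = begin
  partialSum (θ c A) n + (x + (c - N) * A (suc n))
    ≡⟨ cong (_+ (x + (c - N) * A (suc n))) (partialSum-θ c A n) ⟩
  N * A (suc n) + c * partialSum A n + (x + (c - N) * A (suc n))
    ≡⟨ solve 5 (λ N y c p x → N :* y :+ c :* p :+ (x :+ (c :- N) :* y) := x :+ c :* (p :+ y)) refl
         N (A (suc n)) c (partialSum A n) x ⟩
  x + c * (partialSum A n + A (suc n))  ∎
  where
  N = fromℕ (suc n)
  x = fromℕ (2 ℕ.+ n) * A (2 ℕ.+ n)

-- Applying (1 - u) d/du to A/(1 - u) gives A′ plus one extra copy of A/(1 - u), which accounts for
-- the drop from s + 1 to s.
partialSum-θ-suc : ∀ s A → partialSum (θ (fromℕ (suc s)) A) ≗ θ (fromℕ s) (partialSum A)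
partialSum-θ-suc s A n = begin
  partialSum (θ (fromℕ (suc s)) A) n
    ≡⟨ partialSum-θ (fromℕ (suc s)) A n ⟩
  fromℕ (suc n) * y + fromℕ (suc s) * p
    ≡⟨ cong₂ (λ a b → a * y + b * p) (fromℕ-suc n) (fromℕ-suc s) ⟩
  (1ℚ + fromℕ n) * y + (1ℚ + fromℕ s) * p
    ≡⟨ solve 4 (λ n y s p → (con 1ℚ :+ n) :* y :+ (con 1ℚ :+ s) :* p
                         := (con 1ℚ :+ n) :* (p :+ y) :+ (s :- n) :* p) refl
         (fromℕ n) y (fromℕ s) p ⟩
  (1ℚ + fromℕ n) * (p + y) + (fromℕ s - fromℕ n) * p
    ≡⟨ cong (λ a → a * (p + y) + (fromℕ s - fromℕ n) * p) (fromℕ-suc n) ⟨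
  fromℕ (suc n) * (p + y) + (fromℕ s - fromℕ n) * p  ∎
  where
  y = A (suc n)
  p = partialSum A n

-- Each innermost summation passes through θ and lowers its parameter by one, until only (1 - u)
-- d/du is left, whose factor 1 - u the last summation cancels. The induction on s therefore
-- replaces `A` by `partialSum A`.
partialSums-θ : ∀ s A → partialSums (suc s) (θ (fromℕ s) A) ≗ deriv (partialSums s A)
partialSums-θ zero A n = begin
  partialSum (θ 0ℚ A) n  ≡⟨ partialSum-θ 0ℚ A n ⟩
  deriv A n + 0ℚ * partialSum A n
    ≡⟨ solve 2 (λ x y → x :+ con 0ℚ :* y := x) refl (deriv A n) (partialSum A n) ⟩
  deriv A n              ∎
partialSums-θ (suc s) A n = begin
  partialSums (2 ℕ.+ s) (θ (fromℕ (suc s)) A) n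
    ≡⟨ partialSums-partialSum (suc s) (θ (fromℕ (suc s)) A) n ⟨
  partialSums (suc s) (partialSum (θ (fromℕ (suc s)) A)) n
    ≡⟨ partialSums-cong (suc s) (partialSum-θ-suc s A) n ⟩
  partialSums (suc s) (θ (fromℕ s) (partialSum A)) n
    ≡⟨ partialSums-θ s (partialSum A) n ⟩
  fromℕ (suc n) * partialSums s (partialSum A) (suc n)
    ≡⟨ cong (fromℕ (suc n) *_) (partialSums-partialSum s A (suc n)) ⟩
  deriv (partialSums (suc s) A) n  ∎

-- Evaluation of a product of operators D + aᵢ at t = 0

linear : ∀ {n} → (Fin n → ℚ) → Fin n → Series
linear a i = X ⊕ const (a i)

linear⊛-zero : ∀ a Q → ((X ⊕ const a) ⊛ Q) 0 ≡ a * Q 0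
linear⊛-zero a Q = solve 2 (λ a q → (con 0ℚ :+ a) :* q :+ con 0ℚ := a :* q) refl a (Q 0)

linear⊛-suc : ∀ a Q k → ((X ⊕ const a) ⊛ Q) (suc k) ≡ Q k + a * Q (suc k)
linear⊛-suc a Q k = begin
  (0ℚ + a) * Q (suc k) + (shift (X ⊕ const a) ⊛ Q) k
    ≡⟨ cong (λ z → (0ℚ + a) * Q (suc k) + z)
         (trans (⊛-congʳ Q shift-linear k) (⊛-identityˡ Q k)) ⟩
  (0ℚ + a) * Q (suc k) + Q k
    ≡⟨ solve 3 (λ a x y → (con 0ℚ :+ a) :* x :+ y := y :+ a :* x) refl a (Q (suc k)) (Q k) ⟩
  Q k + a * Q (suc k)  ∎
  where
  shift-linear : shift (X ⊕ const a) ≗ const 1ℚ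
  shift-linear zero    = refl
  shift-linear (suc _) = refl

product-linear-vanish : ∀ {n} (a : Fin n → ℚ) {k} → n ℕ.< k → product (linear a) k ≡ 0ℚ
product-linear-vanish {zero}  a {suc k} _         = refl
product-linear-vanish {suc n} a {suc k} (s≤s n<k) = begin
  product (linear a) (suc k)
    ≡⟨ linear⊛-suc (a Fin.zero) Q k ⟩
  Q k + a Fin.zero * Q (suc k)
    ≡⟨ cong₂ (λ x y → x + a Fin.zero * y)
         (product-linear-vanish (a ∘ Fin.suc) n<k)
         (product-linear-vanish (a ∘ Fin.suc) (ℕ.m<n⇒m<1+n n<k)) ⟩
  0ℚ + a Fin.zero * 0ℚ
    ≡⟨ solve 1 (λ x → con 0ℚ :+ x :* con 0ℚ := con 0ℚ) refl (a Fin.zero) ⟩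
  0ℚ  ∎
  where Q = product (linear (a ∘ Fin.suc))

-- Q(D) f at t = 0, for a polynomial Q of degree at most n.
applyAt0 : ℕ → Series → Series → ℚ
applyAt0 n Q f = ∑< (suc n) (λ k → Q k * (fromℕ (k !) * f k))

applyAt0-cong : ∀ n Q {f g} → f ≗ g → applyAt0 n Q f ≡ applyAt0 n Q g
applyAt0-cong n Q f≗g = ∑<-cong (suc n) (λ k → cong (λ z → Q k * (fromℕ (k !) * z)) (f≗g k))

-- A factor X + a of the polynomial is moved onto the series as the operator D + a. The hypothesis
-- on `Q` removes the top term of the part multiplied by a, so that both parts range over k ≤ n.
applyAt0-linear⊛ : ∀ n a Q f → Q (suc n) ≡ 0ℚ →
  applyAt0 (suc n) ((X ⊕ const a) ⊛ Q) f ≡ applyAt0 n Q (deriv f ⊕ a · f)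
applyAt0-linear⊛ n a Q f Qₙ₊₁ = begin
  ((X ⊕ const a) ⊛ Q) 0 * b 0 + ∑< (suc n) (λ k → ((X ⊕ const a) ⊛ Q) (suc k) * b (suc k))
    ≡⟨ cong₂ (λ x y → x * b 0 + y) (linear⊛-zero a Q)
         (∑<-cong (suc n) (λ k → trans (cong (_* b (suc k)) (linear⊛-suc a Q k))
           (solve 4 (λ q a q′ b → (q :+ a :* q′) :* b := q :* b :+ a :* (q′ :* b)) refl
             (Q k) a (Q (suc k)) (b (suc k))))) ⟩
  a * Q 0 * b 0 + ∑< (suc n) (Qb′ ⊕ shift (a · Qb))
    ≡⟨ cong (λ z → a * Q 0 * b 0 + z) (∑<-+ (suc n) Qb′ (shift (a · Qb))) ⟩
  a * Q 0 * b 0 + (∑< (suc n) Qb′ + ∑< (suc n) (shift (a · Qb)))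
    ≡⟨ solve 5 (λ a q b x y → a :* q :* b :+ (x :+ y) := x :+ (a :* (q :* b) :+ y)) refl
         a (Q 0) (b 0) (∑< (suc n) Qb′) (∑< (suc n) (shift (a · Qb))) ⟩
  ∑< (suc n) Qb′ + ∑< (2 ℕ.+ n) (a · Qb)
    ≡⟨ cong (λ z → ∑< (suc n) Qb′ + z) (∑<-last (suc n) (a · Qb)) ⟩
  ∑< (suc n) Qb′ + (∑< (suc n) (a · Qb) + a * (Q (suc n) * b (suc n)))
    ≡⟨ cong (λ z → ∑< (suc n) Qb′ + (∑< (suc n) (a · Qb) + a * (z * b (suc n)))) Qₙ₊₁ ⟩
  ∑< (suc n) Qb′ + (∑< (suc n) (a · Qb) + a * (0ℚ * b (suc n)))
    ≡⟨ solve 4 (λ x y a b → x :+ (y :+ a :* (con 0ℚ :* b)) := x :+ y) refl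
         (∑< (suc n) Qb′) (∑< (suc n) (a · Qb)) a (b (suc n)) ⟩
  ∑< (suc n) Qb′ + ∑< (suc n) (a · Qb)
    ≡⟨ ∑<-+ (suc n) Qb′ (a · Qb) ⟨
  ∑< (suc n) (Qb′ ⊕ a · Qb)
    -- The term from X uses (k + 1)! f_{k+1} = k! (f′)_k.
    ≡⟨ ∑<-cong (suc n) (λ k → trans
         (cong (λ z → Q k * (z * f (suc k)) + a * Qb k) (fromℕ-* (suc k) (k !)))
         (solve 6 (λ q s k f a f′ → q :* (s :* k :* f) :+ a :* (q :* (k :* f′))
                                 := q :* (k :* (s :* f :+ a :* f′))) refl
           (Q k) (fromℕ (suc k)) (fromℕ (k !)) (f (suc k)) a (f k))) ⟩
  applyAt0 n Q (deriv f ⊕ a · f)  ∎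
  where
  b Qb Qb′ : Series
  b k = fromℕ (k !) * f k
  Qb k = Q k * b k
  Qb′ k = Q k * b (suc k)

-- The first factor turns `A` into θ_s A. For the remaining factors the numbers q + aᵢ start at s +
-- 1, so the induction supplies exactly the s + 1 summations that `partialSums-θ` requires.
applyAt0-product : ∀ n (a : Fin n → ℚ) q s A → (∀ i → q + a i ≡ fromℕ (s ℕ.+ toℕ i)) →
  applyAt0 n (product (linear a)) (exp⊛⊚ q A) ≡ fromℕ (n !) * partialSums s A n
applyAt0-product zero a q s A q+a = begin
  -- The left side fully unfolded: 0!, the constant term of e^{qt} and u⁰ are all 1.
  1ℚ * (1ℚ * (1ℚ * 1ℚ * (A 0 * 1ℚ + 0ℚ) + 0ℚ)) + 0ℚ
    ≡⟨ solve 1 (λ x → con 1ℚ :* (con 1ℚ :* (con 1ℚ :* con 1ℚ :* (x :* con 1ℚ :+ con 0ℚ) :+ con 0ℚ)) :+ con 0ℚ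
         := con 1ℚ :* x) refl (A 0) ⟩
  1ℚ * A 0               ≡⟨ cong (1ℚ *_) (partialSums-zero s) ⟨
  1ℚ * partialSums s A 0  ∎
  where
  partialSums-zero : ∀ s → partialSums s A 0 ≡ A 0
  partialSums-zero zero    = refl
  partialSums-zero (suc s) = partialSums-zero s
applyAt0-product (suc n) a q s A q+a = begin
  applyAt0 (suc n) (product (linear a)) (exp⊛⊚ q A)
    ≡⟨ applyAt0-linear⊛ n a₀ Q (exp⊛⊚ q A) (product-linear-vanish (a ∘ Fin.suc) (ℕ.n<1+n n)) ⟩
  applyAt0 n Q (deriv (exp⊛⊚ q A) ⊕ a₀ · exp⊛⊚ q A)
    ≡⟨ applyAt0-cong n Q (λ k → trans (deriv+-exp⊛⊚ q a₀ A k)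
         (cong (λ c → exp⊛⊚ q (θ c A) k) q+a₀)) ⟩
  applyAt0 n Q (exp⊛⊚ q (θ (fromℕ s) A))
    ≡⟨ applyAt0-product n (a ∘ Fin.suc) q (suc s) (θ (fromℕ s) A)
         (λ i → trans (q+a (Fin.suc i)) (cong fromℕ (ℕ.+-suc s (toℕ i)))) ⟩
  fromℕ (n !) * partialSums (suc s) (θ (fromℕ s) A) n
    ≡⟨ cong (fromℕ (n !) *_) (partialSums-θ s A n) ⟩
  fromℕ (n !) * (fromℕ (suc n) * partialSums s A (suc n))
    ≡⟨ solve 3 (λ x y z → x :* (y :* z) := y :* x :* z) refl
         (fromℕ (n !)) (fromℕ (suc n)) (partialSums s A (suc n)) ⟩
  fromℕ (suc n) * fromℕ (n !) * partialSums s A (suc n)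
    ≡⟨ cong (_* partialSums s A (suc n)) (fromℕ-* (suc n) (n !)) ⟨
  fromℕ (suc n !) * partialSums s A (suc n)  ∎
  where
  a₀ = a Fin.zero
  Q = product (linear (a ∘ Fin.suc))
  q+a₀ : q + a₀ ≡ fromℕ s
  q+a₀ = trans (q+a Fin.zero) (cong fromℕ (ℕ.+-identityʳ s))

-- Both sides of the identity in terms of Li_p(u)/u

Li/u : ℤ → Series
Li/u p m = invPow p (suc m)

H≡partialSums : ∀ p s n → H p s (suc n) ≡ partialSums s (Li/u p) n
H≡partialSums p zero    n = refl
H≡partialSums p (suc s) n = trans
  (sum-cong-≗ {suc n} (λ j → H≡partialSums p s (toℕ j)))
  (sym (partialSum≡∑ (partialSums s (Li/u p)) n))

Li⊚ : ∀ p → Li p ⊚ 1-exp⁻ ≗ (Li/u p ⊚ 1-exp⁻) ⊛ 1-exp⁻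
Li⊚ p n = begin
  0ℚ * (u ⊛^ 0) n + ∑< n term
    ≡⟨ solve 2 (λ x y → con 0ℚ :* x :+ y := y) refl ((u ⊛^ 0) n) (∑< n term) ⟩
  ∑< n term
    -- Dropping the zero constant term of `Li p` left only m < n; the term m = n may be added since
    -- it contains u^(n+1).
    ≡⟨ ∑<-extend (ℕ.n≤1+n n) (λ m n≤m → trans
         (cong (Li/u p m *_) (⊛^-vanish u refl (s≤s n≤m))) (*-zeroʳ (Li/u p m))) ⟩
  ∑< (suc n) term
    ≡⟨ ⊛-⊚ u (Li/u p) u refl n ⟨
  (u ⊛ (Li/u p ⊚ u)) n
    ≡⟨ ⊛-comm u (Li/u p ⊚ u) n ⟩
  ((Li/u p ⊚ u) ⊛ u) n  ∎
  where
  u = 1-exp⁻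
  term : Series
  term m = Li/u p m * (u ⊛ (u ⊛^ m)) n

polyBernoulliGF≗ : ∀ p q → polyBernoulliGF p q ≗ exp⊛⊚ q (Li/u p)
polyBernoulliGF≗ p q n = begin
  (((Li p ⊚ u) ⊘ u) ⊛ exp q) n
    ≡⟨ ⊛-congʳ (exp q) (λ k → trans (⊘-cong u (Li⊚ p) k) (⊛-⊘ (Li/u p ⊚ u) u refl k)) n ⟩
  ((Li/u p ⊚ u) ⊛ exp q) n
    ≡⟨ ⊛-comm (Li/u p ⊚ u) (exp q) n ⟩
  exp⊛⊚ q (Li/u p) n  ∎
  where u = 1-exp⁻

theorem1 : (p : ℤ) (n r : ℕ) (q : ℤ) → 0ℤ ℤ.≤ q ℤ.+ + r →
    ∑[ k ≤ n ] (rStirling₁ r n (toℕ k) * B p (toℕ k) (q / 1))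
    ≡ + (n !) / 1 * H p ∣ q ℤ.+ + r ∣ (suc n)
theorem1 p n r q 0≤q+r = begin
  -- This is the sum of the theorem by definition: k! times the k-th coefficient is `B p k`.
  applyAt0 n (risingFactorial r n) (polyBernoulliGF p (fromℤ q))
    ≡⟨ applyAt0-cong n (risingFactorial r n) (polyBernoulliGF≗ p (fromℤ q)) ⟩
  applyAt0 n (risingFactorial r n) (exp⊛⊚ (fromℤ q) (Li/u p))
    ≡⟨ applyAt0-product n (λ i → fromℕ (r ℕ.+ toℕ i)) (fromℤ q) s (Li/u p) shifted ⟩
  fromℕ (n !) * partialSums s (Li/u p) n
    ≡⟨ cong (fromℕ (n !) *_) (H≡partialSums p s n) ⟨
  fromℕ (n !) * H p s (suc n)  ∎
  where
  s = ∣ q ℤ.+ + r ∣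
  shifted : ∀ (i : Fin n) → fromℤ q + fromℕ (r ℕ.+ toℕ i) ≡ fromℕ (s ℕ.+ toℕ i)
  shifted i = begin
    fromℤ q + fromℕ (r ℕ.+ toℕ i)        ≡⟨ fromℤ-+ q (+ (r ℕ.+ toℕ i)) ⟩
    fromℤ (q ℤ.+ (+ r ℤ.+ + toℕ i))      ≡⟨ cong fromℤ (ℤ.+-assoc q (+ r) (+ toℕ i)) ⟨
    -- Here q + r ≥ 0 identifies the absolute value `s` with q + r itself.
    fromℤ (q ℤ.+ + r ℤ.+ + toℕ i)        ≡⟨ cong (λ z → fromℤ (z ℤ.+ + toℕ i)) (ℤ.0≤i⇒+∣i∣≡i 0≤q+r) ⟨
    fromℕ (s ℕ.+ toℕ i)                  ∎
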